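{- The tenth order mock theta function $\psi_{10}(q)=\sum_{n\ge0}\frac{q^{\binom{n+1}2}}{(q;q^2)_n}$ is the generating function $\sum_\pi q^{|\pi|}$ over partitions $\pi$ with $n$ copies of $n$ (including the empty one) in which, with parts in ascending lexicographic order, the weighted difference between each part and the preceding one is exactly $-1$, and the smallest part is of the form $j_j$.
   Context: $M=\{m_i: 1\le i\le m\}$; a partition with $n$ copies of $n$ is a finite multiset of elements of $M$, $|\pi|$ the sum of values. Lexicographic order: $m_i>n_j$ iff $m>n$, or $m=n$ and $i>j$. Weighted difference $((m_i-n_j))=m-n-i-j$. $(a;q)_n=\prod_{j=0}^{n-1}(1-aq^j)$. -}

module Defs where

open import Data.Fin.Base using (Fin; zero; suc; toℕ)
open import Data.Fin.Properties using (toℕ≤pred[n])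
open import Data.Integer.Base as ℤ using (ℤ; +_; 0ℤ; 1ℤ; -1ℤ)
import Data.Integer.Properties as ℤ
open import Data.List.Base using (List; map; head)
open import Data.List.Relation.Binary.Permutation.Propositional using (_↭_; ↭-setoid)
open import Data.List.Relation.Unary.Linked using (Linked)
import Data.List.Relation.Unary.Sorted.TotalOrder as Sorted
import Data.Maybe.Relation.Unary.All as Maybe
open import Data.Nat.Base as ℕ using (ℕ; zero; suc; _∸_; _≤_; _<_; s≤s)
open import Data.Nat.Combinatorics using (_C_; nC1≡n; nCk+nC[k+1]≡[n+1]C[k+1])
open import Data.Nat.ListAction using (sum)
import Data.Nat.Properties as ℕ
open import Data.Product.Base using (∃-syntax; _×_; _,_; proj₁)
open import Data.Product.Relation.Binary.Lex.NonStrict using (×-totalOrder)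
open import Data.Vec.Base using (Vec; []; _∷_; lookup)
open import Function.Bundles using (Bijection)
open import Relation.Binary.Bundles using (Setoid; TotalOrder)
import Relation.Binary.Construct.On as On
open import Relation.Binary.PropositionalEquality
  using (_≡_; _≗_; refl; sym; trans; cong; cong₂; setoid)

open import Algebra.Properties.CommutativeMonoid.Sum ℤ.+-0-commutativeMonoid
  using (sum-syntax; sum⁺-syntax; sum-cong-≗; sum-replicate-zero)

-- Formal power series in q: f n is the coefficient of qⁿ.
PowerSeries : Set
PowerSeries = ℕ → ℤ

infixl 6 _-_
infixl 7 _*_ _/_
infixr 8 _^_
infix  9 _⁻¹

𝟙 : PowerSeries
𝟙 zero    = 1ℤ
𝟙 (suc _) = 0ℤ

q : PowerSeries
q 1 = 1ℤ
q _ = 0ℤ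

_-_ : PowerSeries → PowerSeries → PowerSeries
(f - g) n = f n ℤ.- g n

_*_ : PowerSeries → PowerSeries → PowerSeries
(f * g) n = ∑[ i ≤ n ] (f (toℕ i) ℤ.* g (n ∸ toℕ i))

_^_ : PowerSeries → ℕ → PowerSeries
f ^ zero  = 𝟙
f ^ suc n = f * f ^ n

-- The coefficients gₙ , … , g₁ , g₀ of the inverse g of a series f with
-- constant term 1, from the recurrence g₀ = 1, gₙ₊₁ = - ∑_{i ≤ n} fᵢ₊₁ gₙ₋ᵢ.
inverseCoefficients : PowerSeries → ∀ n → Vec ℤ (suc n)
inverseCoefficients f zero    = 1ℤ ∷ []
inverseCoefficients f (suc n) =
  (ℤ.- (∑[ i ≤ n ] (f (suc (toℕ i)) ℤ.* lookup gs i))) ∷ gs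
  where gs = inverseCoefficients f n

-- Meaningful only for series with constant term 1; see ⁻¹-inverseʳ.
_⁻¹ : PowerSeries → PowerSeries
(f ⁻¹) n = lookup (inverseCoefficients f n) zero

_/_ : PowerSeries → PowerSeries → PowerSeries
f / g = f * g ⁻¹

lookup-inverse : ∀ f n (i : Fin (suc n)) →
                 lookup (inverseCoefficients f n) i ≡ (f ⁻¹) (n ∸ toℕ i)
lookup-inverse f n       zero    = refl
lookup-inverse f (suc n) (suc i) = lookup-inverse f n i

⁻¹-inverseʳ : ∀ f → f 0 ≡ 1ℤ → f * f ⁻¹ ≗ 𝟙
⁻¹-inverseʳ f f₀≡1 zero rewrite f₀≡1 = refl
⁻¹-inverseʳ f f₀≡1 (suc n) = trans
  (cong₂ ℤ._+_
    (trans (cong (ℤ._* (f ⁻¹) (suc n)) f₀≡1) (ℤ.*-identityˡ _))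
    (sum-cong-≗ {suc n} λ i →
      cong (f (suc (toℕ i)) ℤ.*_) (sym (lookup-inverse f n i))))
  (ℤ.+-inverseˡ (∑[ i ≤ n ] (f (suc (toℕ i)) ℤ.* lookup (inverseCoefficients f n) i)))

-- Every coefficient is nonzero in only finitely many terms.
Summable : (ℕ → PowerSeries) → Set
Summable t = ∀ N → ∃[ K ] ∀ n → K ≤ n → t n N ≡ 0ℤ

∑∞ : (t : ℕ → PowerSeries) → Summable t → PowerSeries
∑∞ t summable N = ∑[ n < proj₁ (summable N) ] t (toℕ n) N

-- qPochhammer a b n is (a;b)ₙ = ∏_{j < n} (1 - a bʲ).
qPochhammer : PowerSeries → PowerSeries → ℕ → PowerSeries
qPochhammer a b zero    = 𝟙
qPochhammer a b (suc n) = qPochhammer a b n * (𝟙 - a * b ^ n)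

qPochhammer-constant : ∀ b n → qPochhammer q b n 0 ≡ 1ℤ
qPochhammer-constant b zero    = refl
qPochhammer-constant b (suc n) rewrite qPochhammer-constant b n = refl

ψ₁₀-term : ℕ → PowerSeries
ψ₁₀-term n = q ^ (suc n C 2) / qPochhammer q (q ^ 2) n

∑-zero : ∀ n {t : Fin n → ℤ} → (∀ i → t i ≡ 0ℤ) → ∑[ i < n ] t i ≡ 0ℤ
∑-zero n t≗0 = trans (sum-cong-≗ {n} t≗0) (sum-replicate-zero n)

q*-suc : ∀ f n → (q * f) (suc n) ≡ f n
q*-suc f n = trans (ℤ.+-identityˡ _)
  (trans (cong₂ ℤ._+_ (ℤ.*-identityˡ (f n)) (∑-zero n λ _ → refl))
         (ℤ.+-identityʳ (f n)))

q^-vanishes : ∀ k {n} → n < k → (q ^ k) n ≡ 0ℤ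
q^-vanishes (suc k) {zero}  _         = refl
q^-vanishes (suc k) {suc n} (s≤s n<k) = trans (q*-suc (q ^ k) n) (q^-vanishes k n<k)

q^*-vanishes : ∀ k f {n} → n < k → (q ^ k * f) n ≡ 0ℤ
q^*-vanishes k f {n} n<k = ∑-zero (suc n) λ i →
  cong (ℤ._* f (n ∸ toℕ i)) (q^-vanishes k (ℕ.≤-<-trans (toℕ≤pred[n] i) n<k))

n≤[n+1]C2 : ∀ n → n ≤ suc n C 2
n≤[n+1]C2 n = ℕ.≤-trans (ℕ.m≤m+n n (n C 2))
  (ℕ.≤-reflexive (trans (cong (ℕ._+ n C 2) (sym (nC1≡n n))) (nCk+nC[k+1]≡[n+1]C[k+1] n 1)))

ψ₁₀-summable : Summable ψ₁₀-term
ψ₁₀-summable N = suc N , λ n N<n →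
  q^*-vanishes (suc n C 2) (qPochhammer q (q ^ 2) n ⁻¹) (ℕ.<-≤-trans N<n (n≤[n+1]C2 n))

ψ₁₀ : PowerSeries
ψ₁₀ = ∑∞ ψ₁₀-term ψ₁₀-summable

-- The part m_i has value m and copy i.
record Part : Set where
  constructor mkPart
  field
    value       : ℕ
    copy        : ℕ
    .1≤copy     : 1 ≤ copy
    .copy≤value : copy ≤ value

open Part public

lexicographic : TotalOrder _ _ _
lexicographic =
  On.totalOrder (×-totalOrder ℕ.≤-decTotalOrder ℕ.≤-totalOrder) (λ p → value p , copy p)

weightedDifference : Part → Part → ℤ
weightedDifference p r = + value p ℤ.- + value r ℤ.- + copy p ℤ.- + copy r

-- A partition is a finite multiset of parts: lists up to permutation.
Partition : Setoid _ _
Partition = ↭-setoid {A = Part}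

∣_∣ : List Part → ℕ
∣ π ∣ = sum (map value π)

Ascending : List Part → Set
Ascending = Sorted.Sorted lexicographic

-- The conditions refer to the arrangement σ of π in ascending order, whose
-- head is the smallest part; the last one is vacuous for the empty partition.
Admissible : List Part → Set
Admissible π = ∃[ σ ] (σ ↭ π × Ascending σ
  × Linked (λ r p → weightedDifference p r ≡ -1ℤ) σ
  × Maybe.All (λ p → copy p ≡ value p) (head σ))

-- F = ∑ q^(weight x), summed over the x (up to ≈) satisfying P: for every N,
-- exactly k such x have weight N, where k is the coefficient of q^N in F.
IsGeneratingFunction : ∀ {c ℓ p} (S : Setoid c ℓ) → let open Setoid S in
                       (weight : Carrier → ℕ) (P : Carrier → Set p) → PowerSeries → Set _
IsGeneratingFunction S weight P F =
  ∀ N → ∃[ k ] F N ≡ + k × Bijection (setoid (Fin k)) (OfWeight N)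
  where
  open Setoid S using (Carrier)
  OfWeight : ℕ → Setoid _ _
  OfWeight N = On.setoid S λ (x : ∃[ x ] (P x × weight x ≡ N)) → proj₁ x

{-# OPTIONS --safe #-}

-- A chain of weighted differences -1 starting at some j_j is determined by its
-- copies c₁ , … , cₙ, which may be arbitrary positive integers: the value of
-- the k-th part is 2 (c₁ + … + cₖ₋₁) + cₖ - (k - 1). With cₖ = 1 + dₖ, the
-- values sum to n (n + 1) / 2 + ∑ₖ (2 (n - k) + 1) dₖ, so the chains with n
-- parts contribute q^(n(n+1)/2) / ((1 - q) (1 - q³) ⋯ (1 - q²ⁿ⁻¹)).

module Submission where

open import Defs

open import Data.Empty using (⊥-elim)
open import Data.Fin.Base using (Fin; zero; suc; toℕ)
open import Data.Fin.Properties using (0↔⊥; +↔⊎)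
open import Data.Integer.Base as ℤ using (ℤ; +_; 0ℤ; 1ℤ; -1ℤ)
import Data.Integer.Properties as ℤ
import Data.Integer.Solver as ℤ-Solver
open import Data.List.Base using (List; []; _∷_; head)
open import Data.List.Relation.Binary.Permutation.Propositional
  using (_↭_; ↭-refl; ↭-trans; ↭-reflexive; ↭⇒↭ₛ′)
open import Data.List.Relation.Binary.Permutation.Propositional.Properties using (map⁺)
open import Data.List.Relation.Binary.Pointwise using (Pointwise; []; _∷_)
open import Data.List.Relation.Unary.Linked using (Linked; []; [-]; _∷_)
open import Data.List.Relation.Unary.Sorted.TotalOrder.Properties using (↗↭↗⇒≋)
open import Data.Maybe.Relation.Unary.All as Maybe using (just; nothing)
open import Data.Nat.Base as ℕ using (ℕ; zero; suc; _≤_; _<_; z≤n; s≤s)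
open import Data.Nat.Combinatorics using (_C_; nC1≡n; nCk+nC[k+1]≡[n+1]C[k+1])
open import Data.Nat.Induction using (<-rec)
open import Data.Nat.ListAction.Properties using (sum-↭)
import Data.Nat.Properties as ℕ
import Data.Nat.Solver as ℕ-Solver
open import Data.Product.Base using (∃; ∃-syntax; _×_; _,_; proj₁; proj₂)
open import Data.Sum.Base using (_⊎_; inj₁; inj₂)
open import Data.Sum.Function.Propositional using (_⊎-↔_)
open import Data.Vec.Base using (Vec; []; _∷_)
open import Function.Base using (_∘_)
open import Function.Bundles using (Bijection; _↔_; Inverse; mk↔ₛ′)
open import Function.Properties.Inverse using (↔-trans)
open import Relation.Binary.Bundles using (Setoid; TotalOrder)
import Relation.Binary.Construct.On as On
open import Relation.Binary.PropositionalEquality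
  using (_≡_; _≗_; refl; sym; trans; cong; cong₂; subst; setoid; module ≡-Reasoning)
open import Relation.Nullary.Negation.Core using (¬_)

open import Algebra.Properties.CommutativeMonoid.Sum ℤ.+-0-commutativeMonoid
  using (sum-syntax; sum-cong-≗)
open import Algebra.Properties.AbelianGroup ℤ.+-0-abelianGroup using (∙-cancelʳ)

private
  variable
    n : ℕ
    f f′ g g′ h : PowerSeries

-- Power series

-- Inductions on the coefficient use that (f * g) (suc n) unfolds to
-- f 0 ℤ.* g (suc n) ℤ.+ ((f ∘ suc) * g) n.

*-cong : f ≗ f′ → g ≗ g′ → f * g ≗ f′ * g′
*-cong f≗f′ g≗g′ n =
  sum-cong-≗ {suc n} λ i → cong₂ ℤ._*_ (f≗f′ (toℕ i)) (g≗g′ (n ℕ.∸ toℕ i))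

*-congˡ : ∀ f → g ≗ g′ → f * g ≗ f * g′
*-congˡ f = *-cong {f = f} λ _ → refl

*-identityˡ : ∀ f → 𝟙 * f ≗ f
*-identityˡ f zero    = trans (ℤ.+-identityʳ _) (ℤ.*-identityˡ (f 0))
*-identityˡ f (suc n) = trans
  (cong₂ ℤ._+_ (ℤ.*-identityˡ (f (suc n))) (∑-zero (suc n) λ _ → refl))
  (ℤ.+-identityʳ (f (suc n)))

*-identityʳ : ∀ f → f * 𝟙 ≗ f
*-identityʳ f zero    = trans (ℤ.+-identityʳ _) (ℤ.*-identityʳ (f 0))
*-identityʳ f (suc n) = trans
  (cong₂ ℤ._+_ (ℤ.*-zeroʳ (f 0)) (*-identityʳ (f ∘ suc) n))
  (ℤ.+-identityˡ (f (suc n)))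

*-distribˡ-- : ∀ f g h → f * (g - h) ≗ f * g - f * h
*-distribˡ-- f g h zero = solve 3
  (λ a b c → a :* (b :- c) :+ con 0ℤ := (a :* b :+ con 0ℤ) :- (a :* c :+ con 0ℤ))
  refl (f 0) (g 0) (h 0)
  where open ℤ-Solver.+-*-Solver
*-distribˡ-- f g h (suc n) = trans
  (cong (ℤ._+_ (f 0 ℤ.* (g (suc n) ℤ.- h (suc n)))) (*-distribˡ-- (f ∘ suc) g h n))
  (solve 5
    (λ a b c x y → a :* (b :- c) :+ (x :- y) := (a :* b :+ x) :- (a :* c :+ y))
    refl (f 0) (g (suc n)) (h (suc n)) (((f ∘ suc) * g) n) (((f ∘ suc) * h) n))
  where open ℤ-Solver.+-*-Solver

*-distribʳ-- : ∀ f g h → (f - g) * h ≗ f * h - g * h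
*-distribʳ-- f g h zero = solve 3
  (λ a b c → (a :- b) :* c :+ con 0ℤ := (a :* c :+ con 0ℤ) :- (b :* c :+ con 0ℤ))
  refl (f 0) (g 0) (h 0)
  where open ℤ-Solver.+-*-Solver
*-distribʳ-- f g h (suc n) = trans
  (cong (ℤ._+_ ((f 0 ℤ.- g 0) ℤ.* h (suc n))) (*-distribʳ-- (f ∘ suc) (g ∘ suc) h n))
  (solve 5
    (λ a b c x y → (a :- b) :* c :+ (x :- y) := (a :* c :+ x) :- (b :* c :+ y))
    refl (f 0) (g 0) (h (suc n)) (((f ∘ suc) * h) n) (((g ∘ suc) * h) n))
  where open ℤ-Solver.+-*-Solver

-- Since `f 0` is 1, coefficient n of `f * g` is `g n` plus terms in earlier coefficients of `g`, so
-- strong induction on n recovers `g`.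
*-cancelˡ : f 0 ≡ 1ℤ → f * g ≗ f * h → g ≗ h
*-cancelˡ {f} {g} {h} f₀≡1 fg≗fh = <-rec _ step
  where
  open ≡-Reasoning

  head≡ : ∀ a b {r s} → f 0 ℤ.* a ℤ.+ r ≡ f 0 ℤ.* b ℤ.+ s → r ≡ s → a ≡ b
  head≡ a b {r} eq refl = begin
    a          ≡⟨ ℤ.*-identityˡ a ⟨
    1ℤ ℤ.* a   ≡⟨ cong (ℤ._* a) f₀≡1 ⟨
    f 0 ℤ.* a  ≡⟨ ∙-cancelʳ r _ _ eq ⟩
    f 0 ℤ.* b  ≡⟨ cong (ℤ._* b) f₀≡1 ⟩
    1ℤ ℤ.* b   ≡⟨ ℤ.*-identityˡ b ⟩
    b          ∎

  step : ∀ n → (∀ {m} → m < n → g m ≡ h m) → g n ≡ h n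
  step zero    _   = head≡ (g 0) (h 0) (fg≗fh 0) refl
  step (suc n) rec = head≡ (g (suc n)) (h (suc n)) (fg≗fh (suc n))
    (sum-cong-≗ {suc n} λ i →
      cong (f (suc (toℕ i)) ℤ.*_) (rec (s≤s (ℕ.m∸n≤m n (toℕ i)))))

q*-assoc : ∀ f g → (q * f) * g ≗ q * (f * g)
q*-assoc f g zero    = refl
q*-assoc f g (suc n) = begin
  0ℤ ℤ.+ (((q * f) ∘ suc) * g) n  ≡⟨ ℤ.+-identityˡ _ ⟩
  (((q * f) ∘ suc) * g) n         ≡⟨ *-cong {g = g} (q*-suc f) (λ _ → refl) n ⟩
  (f * g) n                       ≡⟨ q*-suc (f * g) n ⟨
  (q * (f * g)) (suc n)           ∎
  where open ≡-Reasoning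

*-q*-suc : ∀ f g n → (f * (q * g)) (suc n) ≡ (f * g) n
*-q*-suc f g zero    = cong₂ (λ x y → x ℤ.+ (y ℤ.+ 0ℤ))
  (cong (f 0 ℤ.*_) (q*-suc g 0)) (ℤ.*-zeroʳ (f 1))
*-q*-suc f g (suc n) =
  cong₂ ℤ._+_ (cong (f 0 ℤ.*_) (q*-suc g (suc n))) (*-q*-suc (f ∘ suc) g n)

*-q* : ∀ f g → f * (q * g) ≗ q * (f * g)
*-q* f g zero    = cong (ℤ._+ 0ℤ) (ℤ.*-zeroʳ (f 0))
*-q* f g (suc n) = trans (*-q*-suc f g n) (sym (q*-suc (f * g) n))

-- Iterating the factor `q` reduces each law for q^k to an induction from the law for a single `q`.
shift : ℕ → PowerSeries → PowerSeries
shift zero    f = f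
shift (suc k) f = q * shift k f

shift-cong : ∀ k → f ≗ g → shift k f ≗ shift k g
shift-cong zero    f≗g = f≗g
shift-cong (suc k) f≗g = *-congˡ q (shift-cong k f≗g)

shift-* : ∀ k f g → shift k f * g ≗ shift k (f * g)
shift-* zero    f g n = refl
shift-* (suc k) f g n =
  trans (q*-assoc (shift k f) g n) (*-congˡ q (shift-* k f g) n)

*-shift : ∀ k f g → f * shift k g ≗ shift k (f * g)
*-shift zero    f g n = refl
*-shift (suc k) f g n =
  trans (*-q* f (shift k g) n) (*-congˡ q (*-shift k f g) n)

q^-* : ∀ k f → q ^ k * f ≗ shift k f
q^-* zero    f n = *-identityˡ f n
q^-* (suc k) f n = trans (q*-assoc (q ^ k) f n) (*-congˡ q (q^-* k f) n)

q²^ : ∀ n → (q ^ 2) ^ n ≗ shift (n ℕ.* 2) 𝟙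
q²^ zero    _ = refl
q²^ (suc n) m = trans (q^-* 2 ((q ^ 2) ^ n) m) (shift-cong 2 (q²^ n) m)

-- The inverse of (q;q²)ₙ

pochhammer : ℕ → PowerSeries
pochhammer = qPochhammer q (q ^ 2)

pochhammer-inverseʳ : ∀ n → pochhammer n * pochhammer n ⁻¹ ≗ 𝟙
pochhammer-inverseʳ n =
  ⁻¹-inverseʳ (pochhammer n) (qPochhammer-constant (q ^ 2) n)

pochhammer⁻¹-zero : pochhammer 0 ⁻¹ ≗ 𝟙
pochhammer⁻¹-zero n =
  trans (sym (*-identityˡ (𝟙 ⁻¹) n)) (pochhammer-inverseʳ 0 n)

-- The last factor 1 - q²ⁿ⁺¹ moves onto `g`, which leaves `pochhammer n` in front, ready to be
-- cancelled.
pochhammer-suc-* : ∀ n g →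
  pochhammer (suc n) * g ≗ pochhammer n * (g - shift (suc (n ℕ.* 2)) g)
pochhammer-suc-* n g m = begin
  ((p * (𝟙 - q * (q ^ 2) ^ n)) * g) m  ≡⟨ *-cong {g = g} suc≗ (λ _ → refl) m ⟩
  ((p - shift k p) * g) m              ≡⟨ *-distribʳ-- p (shift k p) g m ⟩
  (p * g) m ℤ.- (shift k p * g) m      ≡⟨ cong (λ x → (p * g) m ℤ.- x)
                                            (trans (shift-* k p g m) (sym (*-shift k p g m))) ⟩
  (p * g - p * shift k g) m            ≡⟨ *-distribˡ-- p g (shift k g) m ⟨
  (p * (g - shift k g)) m              ∎
  where
  open ≡-Reasoning
  p = pochhammer n
  k = suc (n ℕ.* 2)

  suc≗ : p * (𝟙 - q * (q ^ 2) ^ n) ≗ p - shift k p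
  suc≗ i = begin
    (p * (𝟙 - q * (q ^ 2) ^ n)) i      ≡⟨ *-distribˡ-- p 𝟙 (q * (q ^ 2) ^ n) i ⟩
    (p * 𝟙 - p * (q * (q ^ 2) ^ n)) i  ≡⟨ cong₂ ℤ._-_ (*-identityʳ p i)
                                            (*-congˡ p (*-congˡ q (q²^ n)) i) ⟩
    p i ℤ.- (p * shift k 𝟙) i          ≡⟨ cong (λ x → p i ℤ.- x) (*-shift k p 𝟙 i) ⟩
    p i ℤ.- shift k (p * 𝟙) i          ≡⟨ cong (λ x → p i ℤ.- x)
                                            (shift-cong k (*-identityʳ p) i) ⟩
    (p - shift k p) i                  ∎

-- This is (1 - q²ⁿ⁺¹) G = 1/(q;q²)ₙ with the subtraction moved across, so that both summands on the
-- right can be counted.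
pochhammer⁻¹-suc : ∀ n m →
  (pochhammer (suc n) ⁻¹) m ≡
  (pochhammer n ⁻¹) m ℤ.+ shift (suc (n ℕ.* 2)) (pochhammer (suc n) ⁻¹) m
pochhammer⁻¹-suc n m = begin
  G m
    ≡⟨ solve 2 (λ x y → x := (x :- y) :+ y) refl (G m) (shift k G m) ⟩
  (G - shift k G) m ℤ.+ shift k G m
    ≡⟨ cong (ℤ._+ shift k G m) (difference≗ m) ⟩
  (pochhammer n ⁻¹) m ℤ.+ shift k G m  ∎
  where
  open ≡-Reasoning
  open ℤ-Solver.+-*-Solver
  k = suc (n ℕ.* 2)
  G = pochhammer (suc n) ⁻¹

  difference≗ : G - shift k G ≗ pochhammer n ⁻¹
  difference≗ = *-cancelˡ {f = pochhammer n} (qPochhammer-constant (q ^ 2) n) λ i → begin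
    (pochhammer n * (G - shift k G)) i  ≡⟨ pochhammer-suc-* n G i ⟨
    (pochhammer (suc n) * G) i          ≡⟨ pochhammer-inverseʳ (suc n) i ⟩
    𝟙 i                                 ≡⟨ pochhammer-inverseʳ n i ⟨
    (pochhammer n * pochhammer n ⁻¹) i  ∎

-- Counting

Counts : ℤ → Set → Set
Counts z X = ∃[ k ] z ≡ + k × (Fin k ↔ X)

counts-↔ : ∀ {z X Y} → X ↔ Y → Counts z X → Counts z Y
counts-↔ X↔Y (k , z≡k , e) = k , z≡k , ↔-trans e X↔Y

counts-≡ : ∀ {y z X} → z ≡ y → Counts y X → Counts z X
counts-≡ z≡y = subst (λ z → Counts z _) (sym z≡y)

counts-∅ : ∀ {X} → ¬ X → Counts 0ℤ X
counts-∅ ¬X = 0 , refl , ↔-trans 0↔⊥ (mk↔ₛ′ (λ ()) ¬X (λ x → ⊥-elim (¬X x)) (λ ()))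

counts-⊎ : ∀ {y z X Y} → Counts y X → Counts z Y → Counts (y ℤ.+ z) (X ⊎ Y)
counts-⊎ (k , y≡k , e) (l , z≡l , e′) =
  k ℕ.+ l , cong₂ ℤ._+_ y≡k z≡l , ↔-trans +↔⊎ (e ⊎-↔ e′)

-- Families beyond the cutoff `k` are empty, so a finite sum counts the whole union. Each step
-- splits off index 0 and reindexes the rest.
counts-∑ : ∀ k (z : ℕ → ℤ) (X : ℕ → Set) → (∀ n → k ≤ n → ¬ X n) →
           (∀ n → Counts (z n) (X n)) → Counts (∑[ n < k ] z (toℕ n)) (∃ X)
counts-∑ zero    z X ¬X c = counts-∅ λ (n , x) → ¬X n z≤n x
counts-∑ (suc k) z X ¬X c = counts-↔ split
  (counts-⊎ (c 0) (counts-∑ k (z ∘ suc) (X ∘ suc) (λ n k≤n → ¬X (suc n) (s≤s k≤n)) (c ∘ suc)))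
  where
  split : (X 0 ⊎ ∃ (X ∘ suc)) ↔ ∃ X
  split = mk↔ₛ′
    (λ { (inj₁ x) → 0 , x ; (inj₂ (n , x)) → suc n , x })
    (λ { (zero , x) → inj₁ x ; (suc n , x) → inj₂ (n , x) })
    (λ { (zero , x) → refl ; (suc n , x) → refl })
    (λ { (inj₁ x) → refl ; (inj₂ (n , x)) → refl })

Fibre : {A : Set} → (A → ℕ) → ℕ → Set
Fibre u n = ∃[ a ] u a ≡ n

Fibre-≡ : ∀ {A : Set} {u : A → ℕ} {n} {x y : Fibre u n} → proj₁ x ≡ proj₁ y → x ≡ y
Fibre-≡ refl = cong (_ ,_) (ℕ.≡-irrelevant _ _)

-- The hypothesis is restricted to the one index m = n - k, so that a strong induction can supply
-- it. For n < k the fibre is empty.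
counts-shift : ∀ {A : Set} {u : A → ℕ} k f n →
               (∀ m → k ℕ.+ m ≡ n → Counts (f m) (Fibre u m)) →
               Counts (shift k f n) (Fibre (λ a → k ℕ.+ u a) n)
counts-shift zero    f n       c = c n refl
counts-shift (suc k) f zero    c = counts-∅ λ ()
counts-shift (suc k) f (suc n) c = counts-≡ (q*-suc (shift k f) n)
  (counts-↔
    (mk↔ₛ′ (λ (a , p) → a , cong suc p) (λ (a , p) → a , ℕ.suc-injective p)
           (λ _ → Fibre-≡ refl) (λ _ → Fibre-≡ refl))
    (counts-shift k f n λ m p → c m (cong suc p)))

-- Chains of parts

-- excess (d₁ ∷ … ∷ dₙ ∷ []) = ∑ₖ (2 (n - k) + 1) dₖ
excess : Vec ℕ n → ℕ
excess []                       = 0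
excess (zero ∷ ds)              = excess ds
excess (_∷_ {n = n} (suc d) ds) = suc (n ℕ.* 2) ℕ.+ excess (d ∷ ds)

-- `excess` lowers the first entry by one at a time, to match `pochhammer⁻¹-suc`; the size
-- computation needs the whole contribution of that entry at once.
excess-∷ : ∀ d (ds : Vec ℕ n) → excess (d ∷ ds) ≡ d ℕ.* suc (n ℕ.* 2) ℕ.+ excess ds
excess-∷ zero    ds = refl
excess-∷ {n} (suc d) ds =
  trans (cong (suc (n ℕ.* 2) ℕ.+_) (excess-∷ d ds))
        (sym (ℕ.+-assoc (suc (n ℕ.* 2)) (d ℕ.* suc (n ℕ.* 2)) (excess ds)))

-- The first entry is either zero or positive: the combinatorial counterpart of the two summands in
-- `pochhammer⁻¹-suc`.
excess-fibre-suc : ∀ n m →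
  (Fibre (excess {n}) m ⊎ Fibre (λ (ds : Vec ℕ (suc n)) → suc (n ℕ.* 2) ℕ.+ excess ds) m) ↔
  Fibre (excess {suc n}) m
excess-fibre-suc n m = mk↔ₛ′
  (λ { (inj₁ (ds , p)) → zero ∷ ds , p ; (inj₂ (d ∷ ds , p)) → suc d ∷ ds , p })
  (λ { (zero ∷ ds , p) → inj₁ (ds , p) ; (suc d ∷ ds , p) → inj₂ (d ∷ ds , p) })
  (λ { (zero ∷ ds , p) → refl ; (suc d ∷ ds , p) → refl })
  (λ { (inj₁ (ds , p)) → refl ; (inj₂ (d ∷ ds , p)) → refl })

-- The entries are the multiplicities of the odd numbers 2n - 1, ..., 3, 1 in a partition of m.
counts-excess : ∀ n m → Counts ((pochhammer n ⁻¹) m) (Fibre (excess {n}) m)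
counts-excess zero zero =
  1 , refl , mk↔ₛ′ (λ _ → [] , refl) (λ _ → zero)
                   (λ { ([] , refl) → refl }) (λ { zero → refl })
counts-excess zero (suc m) =
  counts-≡ (pochhammer⁻¹-zero (suc m)) (counts-∅ λ { ([] , ()) })
counts-excess (suc n) = <-rec _ λ m rec →
  counts-≡ (pochhammer⁻¹-suc n m) (counts-↔ (excess-fibre-suc n m)
    (counts-⊎ (counts-excess n m)
      (counts-shift (suc (n ℕ.* 2)) (pochhammer (suc n) ⁻¹) m
        -- The shift 2n + 1 is positive, so the second summand keeps the length but has a smaller
        -- excess.
        λ l eq → rec (subst (l <_) eq (s≤s (ℕ.m≤n+m l (n ℕ.* 2)))))))

-- A chain of weight N is encoded by its length and its copies decreased by one.
Chain : ℕ → Set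
Chain N = ∃[ n ] Fibre (λ (ds : Vec ℕ n) → suc n C 2 ℕ.+ excess ds) N

counts-chains : ∀ N → Counts (ψ₁₀ N) (Chain N)
-- The cutoff `suc N` is the one chosen in `ψ₁₀-summable`, so the sum is `ψ₁₀ N` by definition.
counts-chains N = counts-∑ (suc N) (λ n → ψ₁₀-term n N) _ tooLong λ n →
  counts-≡ (q^-* (suc n C 2) (pochhammer n ⁻¹) N)
    (counts-shift (suc n C 2) (pochhammer n ⁻¹) N λ m _ → counts-excess n m)
  where
  tooLong : ∀ n → N < n → ¬ Fibre (λ (ds : Vec ℕ n) → suc n C 2 ℕ.+ excess ds) N
  tooLong n N<n (ds , refl) =
    ℕ.<⇒≱ N<n (ℕ.≤-trans (n≤[n+1]C2 n) (ℕ.m≤m+n (suc n C 2) (excess ds)))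

-- In terms of value minus copy and copy minus one, the bounds on a part hold for arbitrary natural
-- numbers.
part : ℕ → ℕ → Part
part b d = mkPart (b ℕ.+ suc d) (suc d) (s≤s z≤n) (ℕ.m≤n+m (suc d) b)

-- A part m_i may be followed exactly by the parts (m + i - 1 + j)_j, whence the
-- offset b: the difference value - copy of the first part.
parts : ℕ → Vec ℕ n → List Part
parts b []       = []
parts b (d ∷ ds) = part b d ∷ parts (b ℕ.+ suc d ℕ.+ d) ds

-- An offset b raises all n values by b. The first part, of copy d + 1, raises the offset of the n
-- later ones by 2d + 1; together with its own d + 1 this gives n + 1 for the binomial and (2n + 1)
-- d for the excess.
∣parts∣ : ∀ b (ds : Vec ℕ n) → ∣ parts b ds ∣ ≡ n ℕ.* b ℕ.+ (suc n C 2 ℕ.+ excess ds)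
∣parts∣ b [] = refl
∣parts∣ {suc n} b (d ∷ ds) = begin
  b ℕ.+ suc d ℕ.+ ∣ parts (b ℕ.+ suc d ℕ.+ d) ds ∣
    ≡⟨ cong ((b ℕ.+ suc d) ℕ.+_) (∣parts∣ (b ℕ.+ suc d ℕ.+ d) ds) ⟩
  b ℕ.+ suc d ℕ.+ (n ℕ.* (b ℕ.+ suc d ℕ.+ d) ℕ.+ (T ℕ.+ excess ds))
    ≡⟨ solve 5 (λ b d n t e →
         b :+ (con 1 :+ d) :+ (n :* (b :+ (con 1 :+ d) :+ d) :+ (t :+ e)) :=
         (b :+ n :* b) :+ ((con 1 :+ n :+ t) :+ (d :* (con 1 :+ n :* con 2) :+ e)))
         refl b d n T (excess ds) ⟩
  suc n ℕ.* b ℕ.+ (suc n ℕ.+ T ℕ.+ (d ℕ.* suc (n ℕ.* 2) ℕ.+ excess ds))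
    ≡⟨ cong ((suc n ℕ.* b) ℕ.+_) (cong₂ ℕ._+_ pascal (sym (excess-∷ d ds))) ⟩
  suc n ℕ.* b ℕ.+ (suc (suc n) C 2 ℕ.+ excess (d ∷ ds)) ∎
  where
  open ≡-Reasoning
  open ℕ-Solver.+-*-Solver
  T = suc n C 2

  pascal : suc n ℕ.+ T ≡ suc (suc n) C 2
  pascal = trans (cong (ℕ._+ T) (sym (nC1≡n (suc n)))) (nCk+nC[k+1]≡[n+1]C[k+1] (suc n) 1)

parts-linked : ∀ {R : Part → Part → Set} →
               (∀ b d e → R (part b d) (part (b ℕ.+ suc d ℕ.+ d) e)) →
               ∀ b (ds : Vec ℕ n) → Linked R (parts b ds)
parts-linked r b []           = []
parts-linked r b (d ∷ [])     = [-]
parts-linked r b (d ∷ e ∷ ds) = r b d e ∷ parts-linked r (b ℕ.+ suc d ℕ.+ d) (e ∷ ds)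

parts-ascending : ∀ (ds : Vec ℕ n) → Ascending (parts 0 ds)
parts-ascending = parts-linked step 0
  where
  step : ∀ b d e → TotalOrder._≤_ lexicographic (part b d) (part (b ℕ.+ suc d ℕ.+ d) e)
  -- Values increase strictly, so copies are never compared.
  step b d e = inj₁ (ℕ.<⇒≤ value< , ℕ.<⇒≢ value<)
    where
    value< : b ℕ.+ suc d < b ℕ.+ suc d ℕ.+ d ℕ.+ suc e
    value< = ℕ.≤-<-trans (ℕ.m≤m+n (b ℕ.+ suc d) d) (ℕ.m<m+n _ ℕ.z<s)

parts-admissible : ∀ (ds : Vec ℕ n) → Admissible (parts 0 ds)
parts-admissible ds =
  parts 0 ds , ↭-refl , parts-ascending ds , parts-linked step 0 ds , smallest ds
  where
  open ℤ-Solver.+-*-Solver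

  step : ∀ b d e → weightedDifference (part (b ℕ.+ suc d ℕ.+ d) e) (part b d) ≡ -1ℤ
  step b d e = solve 3 (λ b d e →
    (b :+ (con 1ℤ :+ d) :+ d :+ (con 1ℤ :+ e)) :- (b :+ (con 1ℤ :+ d))
      :- (con 1ℤ :+ e) :- (con 1ℤ :+ d) := con -1ℤ)
    refl (+ b) (+ d) (+ e)

  smallest : ∀ {n} (ds : Vec ℕ n) → Maybe.All (λ p → copy p ≡ value p) (head (parts 0 ds))
  smallest []       = nothing
  smallest (d ∷ ds) = just refl

-- The condition on the smallest part is generalised to offset b, because each weighted difference
-- of -1 fixes the offset of the next part.
parts-surjective : ∀ b {σ} → Linked (λ r p → weightedDifference p r ≡ -1ℤ) σ →
                   Maybe.All (λ p → value p ≡ b ℕ.+ copy p) (head σ) →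
                   ∃[ n ] ∃[ ds ] parts {n} b ds ≡ σ
parts-surjective b [] _ = 0 , [] , refl
parts-surjective b {mkPart _ (suc d) _ _ ∷ []} [-] (just refl) = 1 , d ∷ [] , refl
parts-surjective b {mkPart _ (suc d) _ _ ∷ p ∷ σ} (difference ∷ linked) (just refl) =
  let n , ds , eq = parts-surjective (b ℕ.+ suc d ℕ.+ d) linked (just value≡)
  in suc n , d ∷ ds , cong (part b d ∷_) eq
  where
  open ≡-Reasoning
  open ℤ-Solver.+-*-Solver

  -- The equation for the weighted difference is solved for `value p`.
  value≡ : value p ≡ b ℕ.+ suc d ℕ.+ d ℕ.+ copy p
  value≡ = ℤ.+-injective (begin
    + value p
      ≡⟨ solve 4 (λ v b d c →
           v := (v :- (b :+ (con 1ℤ :+ d)) :- c :- (con 1ℤ :+ d))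
                  :+ (b :+ (con 1ℤ :+ d) :+ (con 1ℤ :+ d) :+ c))
           refl (+ value p) (+ b) (+ d) (+ copy p) ⟩
    weightedDifference p (part b d) ℤ.+ + (b ℕ.+ suc d ℕ.+ suc d ℕ.+ copy p)
      ≡⟨ cong (ℤ._+ + (b ℕ.+ suc d ℕ.+ suc d ℕ.+ copy p)) difference ⟩
    -1ℤ ℤ.+ + (b ℕ.+ suc d ℕ.+ suc d ℕ.+ copy p)
      ≡⟨ solve 3 (λ b d c →
           con -1ℤ :+ (b :+ (con 1ℤ :+ d) :+ (con 1ℤ :+ d) :+ c) :=
           b :+ (con 1ℤ :+ d) :+ d :+ c)
           refl (+ b) (+ d) (+ copy p) ⟩
    + (b ℕ.+ suc d ℕ.+ d ℕ.+ copy p) ∎)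

-- Equal copies give equal first entries, hence equal offsets for the tails.
parts-injective : ∀ {m n} b (ds : Vec ℕ m) (es : Vec ℕ n) →
                  Pointwise (TotalOrder._≈_ lexicographic) (parts b ds) (parts b es) →
                  (m , ds) ≡ (n , es)
parts-injective b []       []       []                   = refl
parts-injective b (d ∷ ds) (_ ∷ es) ((_ , refl) ∷ rest)
  with refl ← parts-injective (b ℕ.+ suc d ℕ.+ d) ds es rest = refl

-- Both lists are ascending, and a multiset has only one ascending arrangement.
parts-↭-injective : ∀ {m n} (ds : Vec ℕ m) (es : Vec ℕ n) →
                    parts 0 ds ↭ parts 0 es → (m , ds) ≡ (n , es)
parts-↭-injective ds es perm = parts-injective 0 ds es
  (↗↭↗⇒≋ lexicographic (parts-ascending ds) (parts-ascending es)
    (↭⇒↭ₛ′ (TotalOrder.isEquivalence lexicographic) perm))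

-- Chains and admissible partitions

Chain-≡ : ∀ {N} {x y : Chain N} →
          (proj₁ x , proj₁ (proj₂ x)) ≡ (proj₁ y , proj₁ (proj₂ y)) → x ≡ y
Chain-≡ refl = cong (_ ,_) (Fibre-≡ refl)

∣parts∣₀ : ∀ (ds : Vec ℕ n) → ∣ parts 0 ds ∣ ≡ suc n C 2 ℕ.+ excess ds
∣parts∣₀ {n} ds = trans (∣parts∣ 0 ds) (cong (ℕ._+ (suc n C 2 ℕ.+ excess ds)) (ℕ.*-zeroʳ n))

-- The setoid local to `IsGeneratingFunction`, written out for the present weight and condition.
AdmissibleOfSize : ℕ → Setoid _ _
AdmissibleOfSize N = On.setoid Partition λ (x : ∃[ π ] (Admissible π × ∣ π ∣ ≡ N)) → proj₁ x

chains-bijection : ∀ {N k} → Fin k ↔ Chain N → Bijection (setoid (Fin k)) (AdmissibleOfSize N)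
chains-bijection {N} {k} e = record
  { to        = λ i → toPartition (to i)
  ; cong      = λ { refl → ↭-refl }
  ; bijective = injective , surjective
  }
  where
  open Inverse e using (to; from; strictlyInverseˡ; strictlyInverseʳ)

  chainParts : Chain N → List Part
  chainParts (_ , ds , _) = parts 0 ds

  toPartition : Chain N → ∃[ π ] (Admissible π × ∣ π ∣ ≡ N)
  toPartition (_ , ds , size) = parts 0 ds , parts-admissible ds , trans (∣parts∣₀ ds) size

  injective : ∀ {i j} → chainParts (to i) ↭ chainParts (to j) → i ≡ j
  injective {i} {j} perm = begin
    i            ≡⟨ strictlyInverseʳ i ⟨
    from (to i)  ≡⟨ cong from (Chain-≡ (parts-↭-injective _ _ perm)) ⟩
    from (to j)  ≡⟨ strictlyInverseʳ j ⟩
    j            ∎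
    where open ≡-Reasoning

  surjective : ∀ (y : ∃[ π ] (Admissible π × ∣ π ∣ ≡ N)) →
               ∃[ i ] (∀ {j} → j ≡ i → chainParts (to j) ↭ proj₁ y)
  surjective (π , (σ , σ↭π , _ , linked , smallest) , ∣π∣≡N)
    -- The ascending arrangement `σ`, rather than `π`, is a list of the form `parts 0 ds`; offset 0
    -- expresses that the smallest part is some j_j.
    with n , ds , refl ← parts-surjective 0 linked (Maybe.map sym smallest) =
    from chain , λ { refl →
      ↭-trans (↭-reflexive (cong chainParts (strictlyInverseˡ chain))) σ↭π }
    where
    chain : Chain N
    chain = n , ds , trans (sym (∣parts∣₀ ds)) (trans (sum-↭ (map⁺ value σ↭π)) ∣π∣≡N)

theorem26 : IsGeneratingFunction Partition ∣_∣ Admissible ψ₁₀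
theorem26 N =
  let k , ψ₁₀≡k , e = counts-chains N
  in k , ψ₁₀≡k , chains-bijection e
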